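{- If $\mathcal{C}$ is one of the clones $\Lambda$ and $V$ of Boolean functions, then the class $\mathcal{C}^{(\geq 4)}$ is reconstructible.
   Context: A Boolean function is a map $f\colon\{0,1\}^n\to\{0,1\}$, $n\ge1$ (its arity). $\Lambda$ is the clone of all polynomial operations of the two-element meet-semilattice $(\{0,1\};\wedge)$ (all constant functions and all conjunctions of a nonempty set of arguments); $V$ is the clone of all polynomial operations of the two-element join-semilattice $(\{0,1\};\vee)$ (all constant functions and all disjunctions of a nonempty set of arguments). Functions may have inessential arguments. $\mathcal C^{(\ge n)}$ is the set of members of $\mathcal C$ of arity at least $n$. For functions $f,g$ of the same arity $n$, $f\equiv g$ (equivalent) means that there is a permutation $\sigma$ of $\{1,\dots,n\}$ with $f(a_1,\dots,a_n)=g(a_{\sigma(1)},\dots,a_{\sigma(n)})$ for all $(a_1,\dots,a_n)$. For $f$ of arity $n\ge2$ and $I=\{i,j\}\subseteq\{1,\dots,n\}$, $i<j$, the identification minor $f_I$ is the function of arity $n-1$ given by $f_I(a_1,\dots,a_{n-1})=f(a_1,\dots,a_{j-1},a_i,a_j,\dots,a_{n-1})$. The deck of $f$ is the multiset of the equivalence classes $f_I/{\equiv}$ over all two-element $I\subseteq\{1,\dots,n\}$. A reconstruction of $f$ is a Boolean function of the same arity with the same deck; $f$ is reconstructible if it is equivalent to all of its reconstructions; a class is reconstructible if all of its members are reconstructible. -}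

module Defs where

open import Algebra.Core using (Op₂)
open import Data.Bool.Base using (Bool; _∧_; _∨_)
open import Data.Fin.Base using (Fin; Fin′; toℕ; inject!)
open import Data.Fin.Permutation as Perm using (Permutation′; _⟨$⟩ʳ_; _⟨$⟩ˡ_; _∘ₚ_)
open import Data.List.Base using (List; map; concatMap; allFin)
import Data.List.Relation.Binary.Permutation.Setoid as PermutationSetoid
open import Data.Nat.Base using (ℕ; suc; _≥_)
open import Data.Product.Base using (Σ; ∃-syntax; _×_; _,_)
open import Data.Vec.Base using (Vec; lookup; tabulate; insertAt)
open import Data.Vec.Properties using (lookup∘tabulate; tabulate∘lookup; tabulate-cong)
open import Level using (0ℓ)
open import Relation.Binary.Bundles using (Setoid)
open import Relation.Binary.PropositionalEquality
  using (_≡_; refl; sym; trans; cong)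
open import Relation.Unary using (Pred)

private
  variable
    n : ℕ

-- Boolean functions have positive arity.  The type also makes sense for
-- n = 0, but decks, and hence reconstructibility, are only considered at
-- arities of the form suc n.
BooleanFunction : ℕ → Set
BooleanFunction n = Vec Bool n → Bool

-- (a₁ , … , aₙ) ↦ (a_σ(1) , … , a_σ(n))
permute : Permutation′ n → Vec Bool n → Vec Bool n
permute σ a = tabulate (λ i → lookup a (σ ⟨$⟩ʳ i))

infix 4 _≃_

_≃_ : BooleanFunction n → BooleanFunction n → Set
_≃_ {n} f g = ∃[ σ ] (∀ (a : Vec Bool n) → f a ≡ g (permute σ a))

permute-id : (a : Vec Bool n) → permute Perm.id a ≡ a
permute-id = tabulate∘lookup

permute-∘ : (σ τ : Permutation′ n) (a : Vec Bool n) →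
            permute τ (permute σ a) ≡ permute (τ ∘ₚ σ) a
permute-∘ σ τ a = tabulate-cong (λ i →
  lookup∘tabulate (λ k → lookup a (σ ⟨$⟩ʳ k)) (τ ⟨$⟩ʳ i))

permute-flip : (σ : Permutation′ n) (a : Vec Bool n) →
               permute σ (permute (Perm.flip σ) a) ≡ a
permute-flip σ a = trans (permute-∘ (Perm.flip σ) σ a)
  (trans (tabulate-cong (λ i → cong (lookup a) (Perm.inverseˡ σ)))
         (tabulate∘lookup a))

≃-setoid : ℕ → Setoid 0ℓ 0ℓ
≃-setoid n = record
  { Carrier = BooleanFunction n
  ; _≈_ = _≃_
  ; isEquivalence = record
    { refl = λ {f} → Perm.id , λ a → cong f (sym (permute-id a))
    ; sym = λ { {f} {g} (σ , eq) → Perm.flip σ , λ a →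
        sym (trans (eq (permute (Perm.flip σ) a)) (cong g (permute-flip σ a))) }
    ; trans = λ { {f} {g} {h} (σ , p) (τ , q) → (τ ∘ₚ σ) , λ a →
        trans (p a) (trans (q (permute σ a)) (cong h (permute-∘ σ τ a))) }
    }
  }

-- A two-element subset {i , j} of Fin n with i < j is the pair (j , i),
-- where i : Fin′ j ranges over the indices below j.
TwoSubset : ℕ → Set
TwoSubset n = Σ (Fin n) Fin′

twoSubsets : ∀ n → List (TwoSubset n)
twoSubsets n = concatMap (λ j → map (j ,_) (allFin (toℕ j))) (allFin n)

-- insertAt a j x = (a₁ , … , aⱼ₋₁ , x , aⱼ , … , aₙ) for a of length n
-- (writing positions from 1), so x = aᵢ lands in the j-th argument of f.
identificationMinor : BooleanFunction (suc n) → TwoSubset (suc n) → BooleanFunction n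
identificationMinor f (j , i) a = f (insertAt a j (lookup a (inject! i)))

-- The multiset of equivalence classes is represented by a list of
-- representatives, and equality of such multisets by _↭_ over ≃-setoid:
-- permutation up to replacing entries by equivalent ones.
deck : BooleanFunction (suc n) → List (BooleanFunction n)
deck {n} f = map (identificationMinor f) (twoSubsets (suc n))

SameDeck : BooleanFunction (suc n) → BooleanFunction (suc n) → Set
SameDeck {n} f g = deck f ↭ deck g
  where open PermutationSetoid (≃-setoid n) using (_↭_)

_IsReconstructionOf_ : BooleanFunction (suc n) → BooleanFunction (suc n) → Set
g IsReconstructionOf f = SameDeck g f

Reconstructible : BooleanFunction (suc n) → Set
Reconstructible {n} f = (g : BooleanFunction (suc n)) → g IsReconstructionOf f → f ≃ g

Class : Set₁
Class = (n : ℕ) → Pred (BooleanFunction n) 0ℓ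

ClassReconstructible : Class → Set
ClassReconstructible C = ∀ n (f : BooleanFunction (suc n)) → C (suc n) f → Reconstructible f

infix 8 _^≥_

_^≥_ : Class → ℕ → Class
(C ^≥ m) n f = n ≥ m × C n f

-- Polynomials in n variables over an algebra (A ; ∙) with one binary operation.
data Polynomial (A : Set) (n : ℕ) : Set where
  var   : Fin n → Polynomial A n
  const : A → Polynomial A n
  _·_   : Polynomial A n → Polynomial A n → Polynomial A n

⟦_⟧ : {A : Set} → Polynomial A n → Op₂ A → Vec A n → A
⟦ var i ⟧   _∙_ a = lookup a i
⟦ const c ⟧ _∙_ a = c
⟦ p · q ⟧   _∙_ a = ⟦ p ⟧ _∙_ a ∙ ⟦ q ⟧ _∙_ a

PolynomialOperation : {A : Set} → Op₂ A → Pred (Vec A n → A) 0ℓ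
PolynomialOperation {n} {A} _∙_ f = ∃[ p ] (∀ (a : Vec A n) → f a ≡ ⟦ p ⟧ _∙_ a)

-- With the constants 0, 1 available, these are exactly the constant functions
-- together with the conjunctions (respectively disjunctions) of a nonempty
-- set of arguments.
Λ : Class
Λ n = PolynomialOperation _∧_

V : Class
V n = PolynomialOperation _∨_

{-# OPTIONS --safe #-}

-- By duality it suffices to treat Λ, whose members preserve binary meets.
-- A pair of arguments (x , y) taking at most three distinct values (xᵢ , yᵢ)
-- is, at arity at least 4, constant on some {i , j}, so it lies in the domain of
-- an identification minor.  Applied to (b , a ⇒ b) and to (a , a ⇒ b), where
-- b ∧ (a ⇒ b) = b and a ∧ (a ⇒ b) = a ∧ b, this shows that a function whose
-- minors all preserve meets preserves meets itself.
-- A meet-preserving function is determined by its values at the top tuple and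
-- at the coatoms, hence up to ≃ by its value at the top and the number of
-- coatoms it maps to 1.  Both can be read off the set of minors.
module Submission where

open import Defs
open import Algebra.Bundles using (CommutativeMonoid)
import Algebra.Lattice.Properties.BooleanAlgebra as BooleanAlgebraProperties
import Algebra.Properties.CommutativeMonoid.Sum as Sum
open import Algebra.Properties.CommutativeSemigroup using (interchange)
open import Data.Bool.Base using (Bool; true; false; not; _∧_; _∨_; if_then_else_)
open import Data.Bool.Properties
  using (∧-comm; ∧-idem; ∧-identityˡ; ∨-idem; ∨-zeroʳ; ∨-conicalˡ; ∨-conicalʳ;
         not-involutive; ¬-not; ∧-commutativeMonoid; ∨-commutativeMonoid; ∨-∧-booleanAlgebra)
  renaming (_≟_ to _≟ᵇ_)
open import Data.Fin.Base using (Fin; zero; suc; Fin′; inject!; punchIn; _<_)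
open import Data.Fin.Patterns using (0F; 1F; 2F)
open import Data.Fin.Permutation as Perm
  using (Permutation′; _⟨$⟩ʳ_; _⟨$⟩ˡ_; inverseˡ; inverseʳ; insert; insert-punchIn)
open import Data.Fin.Properties using (_≟_; any?; pigeonhole; punchInᵢ≢i)
open import Data.List.Membership.Propositional using (_∈_; lose)
import Data.List.Membership.Propositional.Properties as Membership
import Data.List.Relation.Binary.Permutation.Setoid as PermutationSetoid
import Data.List.Relation.Binary.Permutation.Setoid.Properties as PermutationProperties
open import Data.List.Relation.Unary.Any using (satisfied)
import Data.List.Relation.Unary.Any.Properties as Any
open import Data.Nat.Base as ℕ using (ℕ; zero; suc; _+_; _≤_; z≤n; s≤s)
open import Data.Nat.Properties
  using (+-0-commutativeMonoid; +-mono-≤; +-mono-<-≤; +-assoc; +-cancelˡ-≡; ≤-refl; ≤-reflexive;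
         ≤-trans; ≤-antisym; <-irrefl; _≤?_; m≤n+m; module ≤-Reasoning)
open import Data.Product.Base using (_×_; _,_; proj₁; proj₂; ∃-syntax)
open import Data.Vec.Base
  using (Vec; []; _∷_; lookup; map; zipWith; replicate; insertAt; removeAt; _[_]≔_)
open import Data.Vec.Properties
  using (lookup-zipWith; lookup-map; lookup-replicate; lookup∘update; lookup∘update′;
         lookup∘tabulate; tabulate∘lookup; tabulate-cong; tabulate-∘; map-insertAt; map-∘;
         map-cong; map-id; insertAt-punchIn; insertAt-removeAt; zipWith-comm; zipWith-identityˡ)
open import Function.Base using (_∘_)
open import Relation.Binary.Bundles using (Setoid)
open import Relation.Binary.PropositionalEquality
  using (_≡_; _≢_; refl; sym; trans; cong; cong₂; subst; module ≡-Reasoning)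
open import Relation.Nullary using (yes; no; contradiction)

open Sum +-0-commutativeMonoid using (sum; sum-remove; sum-permute; sum-cong-≗)

private
  variable
    n : ℕ
    A B : Set

lookup-ext : {xs ys : Vec A n} → (∀ i → lookup xs i ≡ lookup ys i) → xs ≡ ys
lookup-ext {xs = xs} {ys} eq =
  trans (sym (tabulate∘lookup xs)) (trans (tabulate-cong eq) (tabulate∘lookup ys))

-- Functions that preserve meets or joins

infixr 6 _⊓_

_⊓_ : Vec Bool n → Vec Bool n → Vec Bool n
_⊓_ = zipWith _∧_

MeetPreserving : BooleanFunction n → Set
MeetPreserving f = ∀ a b → f (a ⊓ b) ≡ f a ∧ f b

JoinPreserving : BooleanFunction n → Set
JoinPreserving f = ∀ a b → f (zipWith _∨_ a b) ≡ f a ∨ f b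

-- Idempotence settles the constants, and the interchange law the products. Membership in `Λ` enters
-- the proof only through this lemma.
Λ⇒meetPreserving : (f : BooleanFunction n) → Λ n f → MeetPreserving f
Λ⇒meetPreserving f (p , f≗p) a b =
  trans (f≗p (a ⊓ b)) (trans (preserves p) (sym (cong₂ _∧_ (f≗p a) (f≗p b))))
  where
  preserves : ∀ q → ⟦ q ⟧ _∧_ (a ⊓ b) ≡ ⟦ q ⟧ _∧_ a ∧ ⟦ q ⟧ _∧_ b
  preserves (var i)   = lookup-zipWith _∧_ i a b
  preserves (const c) = sym (∧-idem c)
  preserves (q · r)   = trans (cong₂ _∧_ (preserves q) (preserves r))
    (interchange (CommutativeMonoid.commutativeSemigroup ∧-commutativeMonoid)
      (⟦ q ⟧ _∧_ a) (⟦ q ⟧ _∧_ b) (⟦ r ⟧ _∧_ a) (⟦ r ⟧ _∧_ b))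

V⇒joinPreserving : (f : BooleanFunction n) → V n f → JoinPreserving f
V⇒joinPreserving f (p , f≗p) a b =
  trans (f≗p (zipWith _∨_ a b)) (trans (preserves p) (sym (cong₂ _∨_ (f≗p a) (f≗p b))))
  where
  preserves : ∀ q → ⟦ q ⟧ _∨_ (zipWith _∨_ a b) ≡ ⟦ q ⟧ _∨_ a ∨ ⟦ q ⟧ _∨_ b
  preserves (var i)   = lookup-zipWith _∨_ i a b
  preserves (const c) = sym (∨-idem c)
  preserves (q · r)   = trans (cong₂ _∨_ (preserves q) (preserves r))
    (interchange (CommutativeMonoid.commutativeSemigroup ∨-commutativeMonoid)
      (⟦ q ⟧ _∨_ a) (⟦ q ⟧ _∨_ b) (⟦ r ⟧ _∨_ a) (⟦ r ⟧ _∨_ b))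

-- Comparing decks

infix 4 _⊑_

-- Multiplicities in the deck are not needed: only the sets of classes of minors matter.
_⊑_ : BooleanFunction (suc n) → BooleanFunction (suc n) → Set
f ⊑ g = ∀ I → ∃[ J ] identificationMinor f I ≃ identificationMinor g J

∈-twoSubsets : (I : TwoSubset n) → I ∈ twoSubsets n
∈-twoSubsets (j , i) = Membership.∈-concatMap⁺ _
  (lose (Membership.∈-allFin j) (Membership.∈-map⁺ (j ,_) (Membership.∈-allFin i)))

SameDeck⇒⊑ : (f g : BooleanFunction (suc n)) → SameDeck f g → f ⊑ g
SameDeck⇒⊑ {n} f g eq I = satisfied (Any.map⁻ (∈-resp-↭ eq
  (Any.map⁺ (lose (∈-twoSubsets I) (Setoid.refl (≃-setoid n) {identificationMinor f I})))))
  where open PermutationProperties (≃-setoid n) using (∈-resp-↭)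

-- Meet preservation under permutation and identification of arguments

lookup-permute : (σ : Permutation′ n) (a : Vec Bool n) (i : Fin n) →
                 lookup (permute σ a) i ≡ lookup a (σ ⟨$⟩ʳ i)
lookup-permute σ a = lookup∘tabulate (λ i → lookup a (σ ⟨$⟩ʳ i))

permute-⊓ : (σ : Permutation′ n) (a b : Vec Bool n) → permute σ (a ⊓ b) ≡ permute σ a ⊓ permute σ b
permute-⊓ σ a b = lookup-ext λ i → begin
  lookup (permute σ (a ⊓ b)) i                           ≡⟨ lookup-permute σ (a ⊓ b) i ⟩
  lookup (a ⊓ b) (σ ⟨$⟩ʳ i)                              ≡⟨ lookup-zipWith _∧_ (σ ⟨$⟩ʳ i) a b ⟩
  lookup a (σ ⟨$⟩ʳ i) ∧ lookup b (σ ⟨$⟩ʳ i)              ≡⟨ cong₂ _∧_ (lookup-permute σ a i) (lookup-permute σ b i) ⟨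
  lookup (permute σ a) i ∧ lookup (permute σ b) i        ≡⟨ lookup-zipWith _∧_ i (permute σ a) (permute σ b) ⟨
  lookup (permute σ a ⊓ permute σ b) i                   ∎
  where open ≡-Reasoning

permute-map : (σ : Permutation′ n) (φ : Bool → Bool) (a : Vec Bool n) →
              permute σ (map φ a) ≡ map φ (permute σ a)
permute-map σ φ a = trans (tabulate-cong (λ i → lookup-map (σ ⟨$⟩ʳ i) φ a)) (tabulate-∘ φ _)

meetPreserving-permute : (σ : Permutation′ n) {f : BooleanFunction n} →
                         MeetPreserving f → MeetPreserving (f ∘ permute σ)
meetPreserving-permute σ {f} mp a b =
  trans (cong f (permute-⊓ σ a b)) (mp (permute σ a) (permute σ b))

meetPreserving-≗ : {f g : BooleanFunction n} → (∀ a → f a ≡ g a) → MeetPreserving g → MeetPreserving f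
meetPreserving-≗ f≗g mp a b = trans (f≗g (a ⊓ b)) (trans (mp a b) (sym (cong₂ _∧_ (f≗g a) (f≗g b))))

insertAt-zipWith : (φ : A → A → B) (a b : Vec A n) (j : Fin (suc n)) (x y : A) →
                   insertAt (zipWith φ a b) j (φ x y) ≡ zipWith φ (insertAt a j x) (insertAt b j y)
insertAt-zipWith φ a       b       zero    x y = refl
insertAt-zipWith φ (_ ∷ a) (_ ∷ b) (suc j) x y = cong (_ ∷_) (insertAt-zipWith φ a b j x y)

meetPreserving-minor : (f : BooleanFunction (suc n)) → MeetPreserving f →
                       ∀ I → MeetPreserving (identificationMinor f I)
meetPreserving-minor f mp (j , i) a b = trans
  (cong f (trans (cong (insertAt (a ⊓ b) j) (lookup-zipWith _∧_ (inject! i) a b))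
                 (insertAt-zipWith _∧_ a b j _ _)))
  (mp _ _)

-- Meet preservation passes from `f` to its minors and along `≃`, so it reaches the minors of `g`
-- while nothing is yet known about `g` itself.
⊑⇒meetPreserving-minor : (f g : BooleanFunction (suc n)) → MeetPreserving f → g ⊑ f →
                         ∀ I → MeetPreserving (identificationMinor g I)
⊑⇒meetPreserving-minor f g mp g⊑f I with g⊑f I
... | J , σ , eq =
  meetPreserving-≗ eq (meetPreserving-permute σ {identificationMinor f J} (meetPreserving-minor f mp J))

-- Meet preservation from the minors

-- Positions below `j` keep their index when an entry is inserted at `j`. This turns a pair `i < j`
-- into a `TwoSubset`.
punchIn-inject!-surjective : {i j : Fin (suc n)} → i < j →
                             ∃[ i′ ] punchIn j (inject! {i = j} i′) ≡ i
punchIn-inject!-surjective {suc n} {zero}  {suc j} _         = zero , refl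
punchIn-inject!-surjective {suc n} {suc i} {suc j} (s≤s i<j)
  with i′ , eq ← punchIn-inject!-surjective i<j = suc i′ , cong suc eq

-- The deleted entry survives as its copy. Hence the domain of an identification minor covers the
-- whole hyperplane where the two entries agree.
insertAt-merge : (a : Vec A (suc n)) {i : Fin n} (j : Fin (suc n)) →
                 lookup a (punchIn j i) ≡ lookup a j →
                 insertAt (removeAt a j) j (lookup (removeAt a j) i) ≡ a
insertAt-merge a {i} j eq = trans (cong (insertAt (removeAt a j) j) lookup-removeAt) (insertAt-removeAt a j)
  where
  open ≡-Reasoning
  lookup-removeAt : lookup (removeAt a j) i ≡ lookup a j
  lookup-removeAt = begin
    lookup (removeAt a j) i                                             ≡⟨ insertAt-punchIn (removeAt a j) j (lookup a j) i ⟨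
    lookup (insertAt (removeAt a j) j (lookup a j)) (punchIn j i)       ≡⟨ cong (λ b → lookup b (punchIn j i)) (insertAt-removeAt a j) ⟩
    lookup a (punchIn j i)                                              ≡⟨ eq ⟩
    lookup a j                                                          ∎

infixr 5 _⇒_ _⇨_

_⇒_ : Bool → Bool → Bool
x ⇒ y = not x ∨ y

_⇨_ : Vec Bool n → Vec Bool n → Vec Bool n
_⇨_ = zipWith _⇒_

-- Where `a` is 0, the entry of `b` has no influence on the meet, so implication may overwrite it by
-- 1. This merges the pairs (0,0) and (0,1), leaving three kinds of positions.
⊓-⇨ : (a b : Vec Bool n) → a ⊓ (a ⇨ b) ≡ a ⊓ b
⊓-⇨ a b = lookup-ext λ i → trans (lookup-zipWith _∧_ i a (a ⇨ b))
  (trans (cong (lookup a i ∧_) (lookup-zipWith _⇒_ i a b))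
  (trans (∧-⇒ (lookup a i) (lookup b i)) (sym (lookup-zipWith _∧_ i a b))))
  where
  ∧-⇒ : ∀ x y → x ∧ (x ⇒ y) ≡ x ∧ y
  ∧-⇒ false y = refl
  ∧-⇒ true  y = refl

⊓-⇨-absorbs : (a b : Vec Bool n) → b ⊓ (a ⇨ b) ≡ b
⊓-⇨-absorbs a b = lookup-ext λ i → trans (lookup-zipWith _∧_ i b (a ⇨ b))
  (trans (cong (lookup b i ∧_) (lookup-zipWith _⇒_ i a b)) (absorbs (lookup a i) (lookup b i)))
  where
  absorbs : ∀ x y → y ∧ (x ⇒ y) ≡ y
  absorbs x false = refl
  absorbs x true  = ∨-zeroʳ (not x)

module _ (g : BooleanFunction (suc n)) (mp : ∀ I → MeetPreserving (identificationMinor g I)) where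

  -- The hyperplane is closed under meets, and on it `g` agrees with the minor at `{i , j}`.
  meet-on-hyperplane : {i j : Fin (suc n)} → i < j → (a b : Vec Bool (suc n)) →
                       lookup a i ≡ lookup a j → lookup b i ≡ lookup b j →
                       g (a ⊓ b) ≡ g a ∧ g b
  meet-on-hyperplane {j = j} i<j a b aᵢ≡aⱼ bᵢ≡bⱼ with punchIn-inject!-surjective i<j
  ... | i , refl = begin
    g (a ⊓ b)                ≡⟨ cong g (cong₂ _⊓_ (insertAt-merge a j aᵢ≡aⱼ) (insertAt-merge b j bᵢ≡bⱼ)) ⟨
    g (merge a′ ⊓ merge b′)  ≡⟨ cong g (insertAt-zipWith _∧_ a′ b′ j _ _) ⟨
    g (insertAt (a′ ⊓ b′) j (lookup a′ (inject! i) ∧ lookup b′ (inject! i)))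
                             ≡⟨ cong (λ x → g (insertAt (a′ ⊓ b′) j x)) (lookup-zipWith _∧_ (inject! i) a′ b′) ⟨
    g (merge (a′ ⊓ b′))      ≡⟨ mp (j , i) a′ b′ ⟩
    g (merge a′) ∧ g (merge b′) ≡⟨ cong₂ _∧_ (cong g (insertAt-merge a j aᵢ≡aⱼ)) (cong g (insertAt-merge b j bᵢ≡bⱼ)) ⟩
    g a ∧ g b                ∎
    where
    open ≡-Reasoning
    a′ b′ : Vec Bool n
    a′ = removeAt a j
    b′ = removeAt b j
    merge : Vec Bool n → Vec Bool (suc n)
    merge c = insertAt c j (lookup c (inject! i))

  -- `c` colours the positions, and `κ` and `μ` read the entries of `a` and `b` off the colour. Two
  -- positions share a colour, which puts both tuples on one hyperplane.
  meet-on-few-values : {m : ℕ} → m ℕ.< suc n → (c : Fin (suc n) → Fin m) (κ μ : Fin m → Bool)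
                       (a b : Vec Bool (suc n)) →
                       (∀ i → lookup a i ≡ κ (c i)) → (∀ i → lookup b i ≡ μ (c i)) →
                       g (a ⊓ b) ≡ g a ∧ g b
  meet-on-few-values m<n c κ μ a b a≗κ b≗μ with pigeonhole m<n c
  ... | i , j , i<j , cᵢ≡cⱼ = meet-on-hyperplane i<j a b
    (trans (a≗κ i) (trans (cong κ cᵢ≡cⱼ) (sym (a≗κ j))))
    (trans (b≗μ i) (trans (cong μ cᵢ≡cⱼ) (sym (b≗μ j))))

  module _ (3<n : 3 ℕ.< suc n) (a b : Vec Bool (suc n)) where

    meet-with-implication : g (a ⊓ (a ⇨ b)) ≡ g a ∧ g (a ⇨ b)
    meet-with-implication = meet-on-few-values 3<n (λ i → c (lookup a i) (lookup b i)) κ μ a (a ⇨ b)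
      (λ i → κ-c (lookup a i) (lookup b i))
      (λ i → trans (lookup-zipWith _⇒_ i a b) (μ-c (lookup a i) (lookup b i)))
      where
      -- The colours stand for the values (0,1), (1,0), (1,1) of (aᵢ , aᵢ ⇒ bᵢ); (0,0) cannot occur,
      -- since 0 implies everything.
      c : Bool → Bool → Fin 3
      c false _     = 0F
      c true  false = 1F
      c true  true  = 2F
      κ μ : Fin 3 → Bool
      κ 0F = false
      κ 1F = true
      κ 2F = true
      μ 0F = true
      μ 1F = false
      μ 2F = true
      κ-c : ∀ x y → x ≡ κ (c x y)
      κ-c false y     = refl
      κ-c true  false = refl
      κ-c true  true  = refl
      μ-c : ∀ x y → x ⇒ y ≡ μ (c x y)
      μ-c false y     = refl
      μ-c true  false = refl
      μ-c true  true  = refl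

    meet-below-implication : g (b ⊓ (a ⇨ b)) ≡ g b ∧ g (a ⇨ b)
    meet-below-implication = meet-on-few-values 3<n (λ i → c (lookup a i) (lookup b i)) κ μ b (a ⇨ b)
      (λ i → κ-c (lookup a i) (lookup b i))
      (λ i → trans (lookup-zipWith _⇒_ i a b) (μ-c (lookup a i) (lookup b i)))
      where
      -- The colours stand for the values (0,0), (0,1), (1,1) of (bᵢ , aᵢ ⇒ bᵢ); (1,0) cannot occur,
      -- since `b` lies below `a ⇨ b`.
      c : Bool → Bool → Fin 3
      c _     true  = 2F
      c true  false = 0F
      c false false = 1F
      κ μ : Fin 3 → Bool
      κ 0F = false
      κ 1F = false
      κ 2F = true
      μ 0F = false
      μ 1F = true
      μ 2F = true
      κ-c : ∀ x y → y ≡ κ (c x y)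
      κ-c _     true  = refl
      κ-c true  false = refl
      κ-c false false = refl
      μ-c : ∀ x y → x ⇒ y ≡ μ (c x y)
      μ-c x     true  = ∨-zeroʳ (not x)
      μ-c true  false = refl
      μ-c false false = refl

  meetPreserving-from-minors : 3 ℕ.< suc n → MeetPreserving g
  meetPreserving-from-minors 3<n a b =
    combine (g a) (g b) (g (a ⊓ b)) (g (a ⇨ b)) (g (b ⇨ a)) (meet a b)
      (trans (cong g (zipWith-comm ∧-comm a b)) (meet b a))
      (trans (cong g (sym (⊓-⇨-absorbs a b))) (meet-below-implication 3<n a b))
    where
    meet : ∀ a b → g (a ⊓ b) ≡ g a ∧ g (a ⇨ b)
    meet a b = trans (cong g (sym (⊓-⇨ a b))) (meet-with-implication 3<n a b)
    -- The variables are the values of `g` at `a`, `b`, `a ⊓ b`, `a ⇨ b`, `b ⇨ a`. If `x` or `y` is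
    -- 0, one of the two formulas for `z` gives 0. If both are 1, the third equation forces `u` to
    -- be 1, and hence `z`.
    combine : ∀ x y z u v → z ≡ x ∧ u → z ≡ y ∧ v → y ≡ y ∧ u → z ≡ x ∧ y
    combine false y     z u     v z≡xu z≡yv y≡yu = z≡xu
    combine true  false z u     v z≡xu z≡yv y≡yu = z≡yv
    combine true  true  z true  v z≡xu z≡yv y≡yu = z≡xu

-- Coatoms

ones : ∀ n → Vec Bool n
ones n = replicate n true

coatom : Fin n → Vec Bool n
coatom {n} k = ones n [ k ]≔ false

-- Every tuple other than the top is a meet of coatoms. The induction fixes the first entry at 1 and
-- splits off a leading 0 as a meet with `coatom zero`.
meetPreserving-ext : (f g : BooleanFunction n) → MeetPreserving f → MeetPreserving g →
                     f (ones n) ≡ g (ones n) → (∀ k → f (coatom k) ≡ g (coatom k)) →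
                     ∀ a → f a ≡ g a
meetPreserving-ext f g mf mg top coat []      = top
meetPreserving-ext {suc n} f g mf mg top coat (x ∷ a) = at x
  where
  open ≡-Reasoning
  at-true : f (true ∷ a) ≡ g (true ∷ a)
  at-true = meetPreserving-ext (f ∘ (true ∷_)) (g ∘ (true ∷_))
    (λ b c → mf (true ∷ b) (true ∷ c)) (λ b c → mg (true ∷ b) (true ∷ c)) top (coat ∘ suc) a
  split : false ∷ a ≡ coatom zero ⊓ (true ∷ a)
  split = cong (false ∷_) (sym (zipWith-identityˡ ∧-identityˡ a))
  at : ∀ x → f (x ∷ a) ≡ g (x ∷ a)
  at true  = at-true
  at false = begin
    f (false ∷ a)                         ≡⟨ cong f split ⟩
    f (coatom zero ⊓ (true ∷ a))          ≡⟨ mf _ _ ⟩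
    f (coatom zero) ∧ f (true ∷ a)        ≡⟨ cong₂ _∧_ (coat zero) at-true ⟩
    g (coatom zero) ∧ g (true ∷ a)        ≡⟨ mg _ _ ⟨
    g (coatom zero ⊓ (true ∷ a))          ≡⟨ cong g split ⟨
    g (false ∷ a)                         ∎

lookup-coatom : (k : Fin n) → lookup (coatom k) k ≡ false
lookup-coatom {n} k = lookup∘update k (ones n) false

lookup-coatom′ : {i k : Fin n} → i ≢ k → lookup (coatom k) i ≡ true
lookup-coatom′ {n} {i} i≢k = trans (lookup∘update′ i≢k (ones n) false) (lookup-replicate i true)

permute-ones : (σ : Permutation′ n) → permute σ (ones n) ≡ ones n
permute-ones {n} σ = lookup-ext λ i → trans (lookup-permute σ (ones n) i)
  (trans (lookup-replicate (σ ⟨$⟩ʳ i) true) (sym (lookup-replicate i true)))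

-- Entry `i` of the permuted tuple is entry `σ i` of the original, so the single 0 moves from `σ k`
-- to `k`.
permute-coatom : (σ : Permutation′ n) (k : Fin n) → permute σ (coatom (σ ⟨$⟩ʳ k)) ≡ coatom k
permute-coatom σ k = lookup-ext λ i → trans (lookup-permute σ (coatom (σ ⟨$⟩ʳ k)) i) (at i)
  where
  at : ∀ i → lookup (coatom (σ ⟨$⟩ʳ k)) (σ ⟨$⟩ʳ i) ≡ lookup (coatom k) i
  at i with i ≟ k
  ... | yes refl = trans (lookup-coatom (σ ⟨$⟩ʳ k)) (sym (lookup-coatom k))
  ... | no  i≢k  = trans (lookup-coatom′ (i≢k ∘ injective)) (sym (lookup-coatom′ i≢k))
    where
    injective : σ ⟨$⟩ʳ i ≡ σ ⟨$⟩ʳ k → i ≡ k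
    injective eq = trans (sym (inverseˡ σ)) (trans (cong (σ ⟨$⟩ˡ_) eq) (inverseˡ σ))

insertAt-ones : (j : Fin (suc n)) → insertAt (ones n) j true ≡ ones (suc n)
insertAt-ones {n}     zero    = refl
insertAt-ones {suc n} (suc j) = cong (true ∷_) (insertAt-ones j)

insertAt-ones-false : (j : Fin (suc n)) → insertAt (ones n) j false ≡ coatom j
insertAt-ones-false {n}     zero    = refl
insertAt-ones-false {suc n} (suc j) = cong (true ∷_) (insertAt-ones-false j)

insertAt-coatom : (j : Fin (suc n)) (k : Fin n) → insertAt (coatom k) j true ≡ coatom (punchIn j k)
insertAt-coatom zero    k       = refl
insertAt-coatom (suc j) zero    = cong (false ∷_) (insertAt-ones j)
insertAt-coatom (suc j) (suc k) = cong (true ∷_) (insertAt-coatom j k)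

insertAt-coatom-false : (j : Fin (suc n)) (k : Fin n) →
                        insertAt (coatom k) j false ≡ coatom (punchIn j k) ⊓ coatom j
insertAt-coatom-false {n} j k = begin
  insertAt (coatom k) j false                            ≡⟨ cong (λ a → insertAt a j false) ⊓-ones ⟨
  insertAt (coatom k ⊓ ones n) j (true ∧ false)          ≡⟨ insertAt-zipWith _∧_ (coatom k) (ones n) j true false ⟩
  insertAt (coatom k) j true ⊓ insertAt (ones n) j false ≡⟨ cong₂ _⊓_ (insertAt-coatom j k) (insertAt-ones-false j) ⟩
  coatom (punchIn j k) ⊓ coatom j                        ∎
  where
  open ≡-Reasoning
  ⊓-ones : coatom k ⊓ ones n ≡ coatom k
  ⊓-ones = trans (zipWith-comm ∧-comm (coatom k) (ones n)) (zipWith-identityˡ ∧-identityˡ (coatom k))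

-- Counting coatoms

[_] : Bool → ℕ
[ b ] = if b then 1 else 0

count : (Fin n → Bool) → ℕ
count p = sum (λ i → [ p i ])

count-mono : {p q : Fin n → Bool} → (∀ i → [ p i ] ≤ [ q i ]) → count p ≤ count q
count-mono {zero}  p≤q = z≤n
count-mono {suc n} {p} p≤q = +-mono-≤ (p≤q zero) (count-mono {p = p ∘ suc} (p≤q ∘ suc))

count-mono-< : {p q : Fin (suc n) → Bool} → [ p zero ] ℕ.< [ q zero ] →
               (∀ i → [ p i ] ≤ [ q i ]) → count p ℕ.< count q
count-mono-< {p = p} p₀<q₀ p≤q = +-mono-<-≤ p₀<q₀ (count-mono {p = p ∘ suc} (p≤q ∘ suc))

[]≤1 : ∀ b → [ b ] ≤ 1
[]≤1 false = z≤n
[]≤1 true  = ≤-refl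

-- Otherwise `p` is constantly the negation of `q zero`. If that constant is 0, then `q` has a 1 at
-- `zero` and a larger count; if it is 1, then `q` has a 0 there and a smaller count.
count≡⇒∃ : (p q : Fin (suc n) → Bool) → count p ≡ count q → ∃[ j ] p j ≡ q zero
count≡⇒∃ p q eq with any? (λ j → p j ≟ᵇ q zero)
... | yes found = found
... | no  none  = contradiction eq (absurd (q zero) refl)
  where
  p-const : ∀ b → q zero ≡ b → ∀ j → p j ≡ not b
  p-const b refl j = ¬-not λ eq → none (j , eq)
  absurd : ∀ b → q zero ≡ b → count p ≢ count q
  absurd true q₀ eq = <-irrefl eq (count-mono-<
    (≤-reflexive (trans (cong (suc ∘ [_]) (p-const true q₀ zero)) (sym (cong [_] q₀))))
    λ j → subst (λ b → [ b ] ≤ [ q j ]) (sym (p-const true q₀ j)) z≤n)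
  absurd false q₀ eq = <-irrefl (sym eq) (count-mono-<
    (≤-reflexive (trans (cong (suc ∘ [_]) q₀) (sym (cong [_] (p-const false q₀ zero)))))
    λ j → subst (λ b → [ q j ] ≤ [ b ]) (sym (p-const false q₀ j)) ([]≤1 (q j)))

-- An index `j` with `p j ≡ q zero` is matched with `zero`. Removing both leaves equal counts, and
-- `insert` extends the permutation found for the remaining indices.
count≡⇒permutation : (p q : Fin n → Bool) → count p ≡ count q →
                     ∃[ σ ] (∀ i → p (σ ⟨$⟩ʳ i) ≡ q i)
count≡⇒permutation {zero}  p q eq = Perm.id , λ ()
count≡⇒permutation {suc n} p q eq with count≡⇒∃ p q eq
... | j , pⱼ≡q₀ with count≡⇒permutation (p ∘ punchIn j) (q ∘ suc) counts
  where
  counts : count (p ∘ punchIn j) ≡ count (q ∘ suc)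
  counts = +-cancelˡ-≡ [ p j ] _ _
    (trans (sym (sum-remove {i = j} (λ i → [ p i ])))
           (trans eq (cong (λ b → [ b ] + count (q ∘ suc)) (sym pⱼ≡q₀))))
...   | σ , p∘σ≗q = insert zero j σ , λ
  { zero    → pⱼ≡q₀
  ; (suc k) → trans (cong p (insert-punchIn zero j σ k)) (p∘σ≗q k)
  }

coatomCount : BooleanFunction n → ℕ
coatomCount f = count (λ k → f (coatom k))

coatomCount-≃ : (f g : BooleanFunction n) → f ≃ g → coatomCount f ≡ coatomCount g
coatomCount-≃ f g (σ , f≗g∘σ) = trans (sum-permute (λ k → [ f (coatom k) ]) σ)
  (sum-cong-≗ λ k → cong [_] (trans (f≗g∘σ _) (cong g (permute-coatom σ k))))

-- Coatoms of an identification minor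

module _ (f : BooleanFunction (suc n)) (mp : MeetPreserving f) where

  private
    p : Fin (suc n) → Bool
    p k = f (coatom k)

  -- The identified argument stands for two arguments of `f`, so its coatom lifts to a tuple with
  -- two zeros, the meet of two coatoms.
  identify-coatom : (j : Fin (suc n)) (i : Fin n) →
    f (insertAt (coatom i) j (lookup (coatom i) i)) ≡ p (punchIn j i) ∧ p j
  identify-coatom j i = trans (cong (λ x → f (insertAt (coatom i) j x)) (lookup-coatom i))
    (trans (cong f (insertAt-coatom-false j i)) (mp (coatom (punchIn j i)) (coatom j)))

  identify-coatom′ : (j : Fin (suc n)) {i k : Fin n} → i ≢ k →
    f (insertAt (coatom k) j (lookup (coatom k) i)) ≡ p (punchIn j k)
  identify-coatom′ j {k = k} i≢k =
    trans (cong (λ x → f (insertAt (coatom k) j x)) (lookup-coatom′ i≢k)) (cong f (insertAt-coatom j k))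

[]+[]≡[∨]+[∧] : ∀ x y → [ y ] + [ x ] ≡ [ x ∨ y ] + [ x ∧ y ]
[]+[]≡[∨]+[∧] false false = refl
[]+[]≡[∨]+[∧] false true  = refl
[]+[]≡[∨]+[∧] true  false = refl
[]+[]≡[∨]+[∧] true  true  = refl

-- Identification trades the coatoms at the two merged arguments for one, which carries the
-- conjunction of their values, and keeps all other values. By inclusion-exclusion the loss is their
-- disjunction.
coatomCount-minor : (f : BooleanFunction (2 + n)) → MeetPreserving f →
  ((j , i) : TwoSubset (2 + n)) →
  coatomCount f ≡
  [ f (coatom (punchIn j (inject! i))) ∨ f (coatom j) ] + coatomCount (identificationMinor f (j , i))
coatomCount-minor f mp (j , i′) = begin
  count p                                   ≡⟨ sum-remove {i = j} (λ k → [ p k ]) ⟩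
  [ p j ] + count (p ∘ punchIn j)           ≡⟨ cong ([ p j ] +_) (sum-remove {i = i} (λ k → [ p (punchIn j k) ])) ⟩
  [ p j ] + ([ p (punchIn j i) ] + rest)    ≡⟨ +-assoc [ p j ] _ rest ⟨
  ([ p j ] + [ p (punchIn j i) ]) + rest    ≡⟨ cong (_+ rest) ([]+[]≡[∨]+[∧] (p (punchIn j i)) (p j)) ⟩
  ([ either ] + [ p (punchIn j i) ∧ p j ]) + rest
                                            ≡⟨ +-assoc [ either ] _ rest ⟩
  [ either ] + ([ p (punchIn j i) ∧ p j ] + rest)
                                            ≡⟨ cong ([ either ] +_) minor-count ⟨
  [ either ] + coatomCount (identificationMinor f (j , i′)) ∎
  where
  open ≡-Reasoning
  p = λ k → f (coatom k)
  i = inject! i′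
  rest = count (p ∘ punchIn j ∘ punchIn i)
  either = p (punchIn j i) ∨ p j
  minor-count : coatomCount (identificationMinor f (j , i′)) ≡ [ p (punchIn j i) ∧ p j ] + rest
  minor-count = trans (sum-remove {i = i} (λ k → [ identificationMinor f (j , i′) (coatom k) ]))
    (cong₂ _+_ (cong [_] (identify-coatom f mp j i))
      (sum-cong-≗ λ k → cong [_] (identify-coatom′ f mp j (punchInᵢ≢i i k ∘ sym))))

-- The top tuple lifts to the top tuple under every identification and is fixed by permutations, so
-- a single minor decides.
top-⊑ : (f g : BooleanFunction (2 + n)) → f ⊑ g → f (ones _) ≡ g (ones _)
top-⊑ f g f⊑g with f⊑g (1F , 0F)
... | J@(j , i) , σ , eq = begin
  f (ones _)                                       ≡⟨ eq (ones _) ⟩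
  identificationMinor g J (permute σ (ones _))     ≡⟨ cong (identificationMinor g J) (permute-ones σ) ⟩
  identificationMinor g J (ones _)                 ≡⟨ cong (λ x → g (insertAt (ones _) j x)) (lookup-replicate (inject! i) true) ⟩
  g (insertAt (ones _) j true)                     ≡⟨ cong g (insertAt-ones j) ⟩
  g (ones _)                                       ∎
  where open ≡-Reasoning

-- The three disjunctions leave at most one 0 among the first three values of `q`, whence the 2. The
-- count of `p` is zero, so it is at most the count of the other values of `q`.
count-gap : (p q : Fin (3 + n) → Bool) → (∀ i → p i ≡ false) →
            q 0F ∨ q 1F ≡ true → q 0F ∨ q 2F ≡ true → q 1F ∨ q 2F ≡ true →
            2 + count p ≤ count q
count-gap p q p≡false q₀₁ q₀₂ q₁₂ = begin
  2 + count p                                   ≤⟨ +-mono-≤ (two (q 0F) (q 1F) (q 2F) q₀₁ q₀₂ q₁₂) p≤rest ⟩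
  [ q 0F ] + ([ q 1F ] + [ q 2F ]) + rest       ≡⟨ +-assoc [ q 0F ] _ rest ⟩
  [ q 0F ] + ([ q 1F ] + [ q 2F ] + rest)       ≡⟨ cong ([ q 0F ] +_) (+-assoc [ q 1F ] _ rest) ⟩
  count q                                       ∎
  where
  open ≤-Reasoning
  rest = count (λ i → q (suc (suc (suc i))))
  zeros : ∀ {m} {r : Fin m → Bool} {b : ℕ} → (∀ i → r i ≡ false) → count r ≤ b
  zeros {zero}  r≡false = z≤n
  zeros {suc m} r≡false rewrite r≡false zero = zeros (r≡false ∘ suc)
  p≤rest : count p ≤ rest
  p≤rest = zeros p≡false
  two : ∀ x y z → x ∨ y ≡ true → x ∨ z ≡ true → y ∨ z ≡ true → 2 ≤ [ x ] + ([ y ] + [ z ])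
  two true  true  z    _ _ _ = s≤s (s≤s z≤n)
  two true  false true _ _ _ = ≤-refl
  two false true  true _ _ _ = ≤-refl

-- Passing to a minor at {i , j} lowers the count by [p i ∨ p j].  If the count of f were
-- smaller than that of g, it would never drop from f and always drop from g: f would
-- be 0 at all coatoms and g would be 1 at all but at most one, a difference of at least 2.
coatomCount-≤ : (f g : BooleanFunction (3 + n)) → MeetPreserving f → MeetPreserving g →
                f ⊑ g → g ⊑ f → coatomCount g ≤ coatomCount f
coatomCount-≤ {n} f g mf mg f⊑g g⊑f with coatomCount g ≤? coatomCount f
... | yes g≤f = g≤f
... | no  g≰f = contradiction
  (≤-trans (count-gap p q p≡false (q-pair 1F 0F) (q-pair 2F 0F) (q-pair 2F 1F)) g≤1+f)
  (<-irrefl refl)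
  where
  p q : Fin (3 + n) → Bool
  p k = f (coatom k)
  q k = g (coatom k)

  minor-≤ : ∀ h → MeetPreserving h → ∀ I → coatomCount (identificationMinor h I) ≤ coatomCount h
  minor-≤ h mh (j , i) = ≤-trans
    (m≤n+m _ [ h (coatom (punchIn j (inject! i))) ∨ h (coatom j) ])
    (≤-reflexive (sym (coatomCount-minor h mh (j , i))))

  ≤-minor : ∀ h → MeetPreserving h → ∀ I → coatomCount h ≤ suc (coatomCount (identificationMinor h I))
  ≤-minor h mh (j , i) = ≤-trans (≤-reflexive (coatomCount-minor h mh (j , i)))
    (+-mono-≤ ([]≤1 (h (coatom (punchIn j (inject! i))) ∨ h (coatom j))) ≤-refl)

  minor-g≤f : ∀ I → coatomCount (identificationMinor g I) ≤ coatomCount f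
  minor-g≤f I with J , eq ← g⊑f I =
    ≤-trans (≤-reflexive (coatomCount-≃ (identificationMinor g I) (identificationMinor f J) eq))
            (minor-≤ f mf J)

  g≤minor-f : ∀ J → coatomCount g ≤ suc (coatomCount (identificationMinor f J))
  g≤minor-f J with I , eq ← f⊑g J = ≤-trans (≤-minor g mg I)
    (≤-reflexive (cong suc (sym (coatomCount-≃ (identificationMinor f J) (identificationMinor g I) eq))))

  g≤1+f : coatomCount g ≤ suc (coatomCount f)
  g≤1+f = ≤-trans (g≤minor-f (1F , 0F)) (s≤s (minor-≤ f mf (1F , 0F)))

  -- Without a drop, the minor would have the full count of `g`; being equivalent to a minor of `f`,
  -- it counts at most as many coatoms as `f`.
  q-pair : ∀ j (i : Fin′ j) → q (punchIn j (inject! i)) ∨ q j ≡ true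
  q-pair j i = at _ (coatomCount-minor g mg (j , i))
    where
    at : ∀ b → coatomCount g ≡ [ b ] + coatomCount (identificationMinor g (j , i)) → b ≡ true
    at true  _  = refl
    at false eq = contradiction (≤-trans (≤-reflexive eq) (minor-g≤f (j , i))) g≰f

  -- With a drop, `f` counts one more than its minor. That minor is equivalent to one of `g`, which
  -- falls at most one below `g`, so `f` would count at least as many coatoms as `g`.
  p-pair : ∀ j (i : Fin′ j) → p (punchIn j (inject! i)) ∨ p j ≡ false
  p-pair j i = at _ (coatomCount-minor f mf (j , i))
    where
    at : ∀ b → coatomCount f ≡ [ b ] + coatomCount (identificationMinor f (j , i)) → b ≡ false
    at false _  = refl
    at true  eq = contradiction (≤-trans (g≤minor-f (j , i)) (≤-reflexive (sym eq))) g≰f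

  p≡false : ∀ k → p k ≡ false
  p≡false zero    = ∨-conicalˡ (p 0F) (p 1F) (p-pair 1F 0F)
  p≡false (suc k) = ∨-conicalʳ (p 0F) (p (suc k)) (p-pair (suc k) zero)

-- Reconstruction of meet-preserving functions

meetPreserving-reconstructible : (f g : BooleanFunction (4 + n)) → MeetPreserving f →
                                 f ⊑ g → g ⊑ f → f ≃ g
meetPreserving-reconstructible {n} f g mf f⊑g g⊑f = σ ,
  meetPreserving-ext f (g ∘ permute σ) mf (meetPreserving-permute σ {g} mg)
    (trans (top-⊑ f g f⊑g) (cong g (sym (permute-ones σ))))
    coatoms
  where
  mg : MeetPreserving g
  mg = meetPreserving-from-minors g (⊑⇒meetPreserving-minor f g mf g⊑f) (s≤s (s≤s (s≤s (s≤s z≤n))))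
  permutation : ∃[ σ ] (∀ i → f (coatom (σ ⟨$⟩ʳ i)) ≡ g (coatom i))
  permutation = count≡⇒permutation (λ k → f (coatom k)) (λ k → g (coatom k))
    (≤-antisym (coatomCount-≤ g f mg mf g⊑f f⊑g) (coatomCount-≤ f g mf mg f⊑g g⊑f))
  σ : Permutation′ (4 + n)
  σ = proj₁ permutation
  open ≡-Reasoning
  coatoms : ∀ k → f (coatom k) ≡ g (permute σ (coatom k))
  -- With `k` written as the image of `σ ⟨$⟩ˡ k`, the choice of `σ` moves the value to `g`, and
  -- `permute-coatom` recovers the permuted coatom.
  coatoms k = begin
    f (coatom k)                                     ≡⟨ cong (f ∘ coatom) (inverseʳ σ {k}) ⟨
    f (coatom (σ ⟨$⟩ʳ (σ ⟨$⟩ˡ k)))                   ≡⟨ proj₂ permutation (σ ⟨$⟩ˡ k) ⟩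
    g (coatom (σ ⟨$⟩ˡ k))                            ≡⟨ cong g (permute-coatom σ (σ ⟨$⟩ˡ k)) ⟨
    g (permute σ (coatom (σ ⟨$⟩ʳ (σ ⟨$⟩ˡ k))))       ≡⟨ cong (g ∘ permute σ ∘ coatom) (inverseʳ σ {k}) ⟩
    g (permute σ (coatom k))                         ∎

-- Duality

dual : BooleanFunction n → BooleanFunction n
dual f a = not (f (map not a))

dual-involutive : (f : BooleanFunction n) (a : Vec Bool n) → dual (dual f) a ≡ f a
dual-involutive f a = trans (not-involutive _) (cong f
  (trans (sym (map-∘ not not a)) (trans (map-cong not-involutive a) (map-id a))))

dual-joinPreserving : (f : BooleanFunction n) → JoinPreserving f → MeetPreserving (dual f)
dual-joinPreserving f jp a b = begin
  not (f (map not (a ⊓ b)))                      ≡⟨ cong (not ∘ f) map-not-⊓ ⟩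
  not (f (zipWith _∨_ (map not a) (map not b)))  ≡⟨ cong not (jp _ _) ⟩
  not (f (map not a) ∨ f (map not b))            ≡⟨ deMorgan₂ (f (map not a)) (f (map not b)) ⟩
  dual f a ∧ dual f b                            ∎
  where
  open ≡-Reasoning
  open BooleanAlgebraProperties ∨-∧-booleanAlgebra using (deMorgan₁; deMorgan₂)
  map-not-⊓ : map not (a ⊓ b) ≡ zipWith _∨_ (map not a) (map not b)
  map-not-⊓ = lookup-ext λ i → begin
    lookup (map not (a ⊓ b)) i                          ≡⟨ lookup-map i not (a ⊓ b) ⟩
    not (lookup (a ⊓ b) i)                              ≡⟨ cong not (lookup-zipWith _∧_ i a b) ⟩
    not (lookup a i ∧ lookup b i)                       ≡⟨ deMorgan₁ (lookup a i) (lookup b i) ⟩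
    not (lookup a i) ∨ not (lookup b i)                 ≡⟨ cong₂ _∨_ (lookup-map i not a) (lookup-map i not b) ⟨
    lookup (map not a) i ∨ lookup (map not b) i         ≡⟨ lookup-zipWith _∨_ i (map not a) (map not b) ⟨
    lookup (zipWith _∨_ (map not a) (map not b)) i      ∎

dual-≃ : (f g : BooleanFunction n) → f ≃ g → dual f ≃ dual g
dual-≃ f g (σ , eq) = σ , λ a →
  cong not (trans (eq (map not a)) (cong g (permute-map σ not a)))

dual-≃⁻ : (f g : BooleanFunction n) → dual f ≃ dual g → f ≃ g
dual-≃⁻ f g eq with σ , eq′ ← dual-≃ (dual f) (dual g) eq = σ , λ a →
  trans (sym (dual-involutive f a)) (trans (eq′ a) (dual-involutive g (permute σ a)))

-- Negating all entries commutes with copying one of them.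
minor-dual : (f : BooleanFunction (suc n)) (I : TwoSubset (suc n)) (a : Vec Bool n) →
             identificationMinor (dual f) I a ≡ dual (identificationMinor f I) a
minor-dual f (j , i) a = cong (not ∘ f) (trans (map-insertAt not _ a j)
  (cong (insertAt (map not a) j) (sym (lookup-map (inject! i) not a))))

dual-⊑ : (f g : BooleanFunction (suc n)) → f ⊑ g → dual f ⊑ dual g
dual-⊑ f g f⊑g I with J , eq ← f⊑g I
  with σ , eq′ ← dual-≃ (identificationMinor f I) (identificationMinor g J) eq =
  J , σ , λ a → trans (minor-dual f I a) (trans (eq′ a) (sym (minor-dual g J (permute σ a))))

corollary4p12 : ClassReconstructible (Λ ^≥ 4) × ClassReconstructible (V ^≥ 4)
corollary4p12 =
  -- Matching on the bound exposes the arity as 4 plus some number. `same` relates the deck of `g`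
  -- to that of `f`, so one of the two inclusions uses its symmetric form.
  (λ { _ f (s≤s (s≤s (s≤s (s≤s z≤n))) , f∈Λ) g same →
    meetPreserving-reconstructible f g (Λ⇒meetPreserving f f∈Λ)
      (SameDeck⇒⊑ f g (symmetric f g same)) (SameDeck⇒⊑ g f same) }) ,
  (λ { _ f (s≤s (s≤s (s≤s (s≤s z≤n))) , f∈V) g same →
    dual-≃⁻ f g (meetPreserving-reconstructible (dual f) (dual g)
      (dual-joinPreserving f (V⇒joinPreserving f f∈V))
      (dual-⊑ f g (SameDeck⇒⊑ f g (symmetric f g same)))
      (dual-⊑ g f (SameDeck⇒⊑ g f same))) })
  where
  symmetric : (f g : BooleanFunction (suc n)) → SameDeck g f → SameDeck f g
  symmetric {n} f g = ↭-sym
    where open PermutationSetoid (≃-setoid n) using (↭-sym)
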